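{- Let $v \ge 360$ be an integer. Then \[ \beta(5,v,4) \le \left\lfloor \frac{5v-15}{3} \right\rfloor, \] and \[ \beta(5,v,4) \ge \begin{cases} \frac{5v-27}{3} & \text{if } v \equiv 0 \pmod 3,\\ \frac{5v-32}{3} & \text{if } v \equiv 1 \pmod 3,\\ \frac{5v-22}{3} & \text{if } v \equiv 2 \pmod 3. \end{cases} \]
   Context: For integers $v \ge k \ge 2$, a $(v,k)$-packing is a pair $(X,\mathcal{B})$ where $X$ is a set of $v$ points and $\mathcal{B}$ is a set of $k$-subsets of $X$ (blocks) such that every pair of distinct points lies in at most one block. A partial parallel class (PPC) is a set of pairwise disjoint blocks; its size is the number of blocks. A PPC of size $\rho$ is maximum if the packing has no PPC of size $\rho+1$. $\beta(\rho,v,k)$ denotes the maximum number of blocks in a $(v,k)$-packing in which the maximum PPC has size $\rho$. -}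

module Defs where

open import Data.Nat using (ℕ; suc; _≤_)
open import Data.Fin using (Fin)
open import Data.Fin.Subset using (Subset; ∣_∣; Empty; _∩_) renaming (_∈_ to _∈ₛ_)
open import Data.List using (List; length)
open import Data.List.Membership.Propositional using (_∈_)
open import Data.List.Relation.Binary.Subset.Propositional using (_⊆_)
open import Data.List.Relation.Unary.All using (All)
open import Data.List.Relation.Unary.AllPairs using (AllPairs)
open import Data.List.Relation.Unary.Unique.Propositional using (Unique)
open import Data.Product using (_×_; ∃-syntax)
open import Relation.Nullary using (¬_)
open import Relation.Binary.PropositionalEquality using (_≡_; _≢_)

-- The v points are Fin v, and a finite set of blocks is a duplicate-free
-- list, so that `length` is its cardinality.
record Packing (v k : ℕ) : Set where
  field
    blocks      : List (Subset v)
    distinct    : Unique blocks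
    block-size  : All (λ B → ∣ B ∣ ≡ k) blocks
    at-most-one : ∀ {x y : Fin v} → x ≢ y →
                  ∀ {B C} → B ∈ blocks → C ∈ blocks →
                  x ∈ₛ B → y ∈ₛ B → x ∈ₛ C → y ∈ₛ C → B ≡ C

open Packing public

Disjoint : ∀ {v} → Subset v → Subset v → Set
Disjoint B C = Empty (B ∩ C)

record PartialParallelClass {v k : ℕ} (P : Packing v k) : Set where
  field
    members  : List (Subset v)
    distinct : Unique members
    ⊆-blocks : members ⊆ blocks P
    disjoint : AllPairs Disjoint members

  size : ℕ
  size = length members

HasPPC : ∀ {v k} → Packing v k → ℕ → Set
HasPPC P ρ = ∃[ Q ] PartialParallelClass.size {P = P} Q ≡ ρ

MaximumPPCSize : ∀ {v k} → Packing v k → ℕ → Set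
MaximumPPCSize P ρ = HasPPC P ρ × ¬ HasPPC P (suc ρ)

-- `Isβ ρ v k b` says that β(ρ,v,k) exists and equals b.  It is a relation
-- because for some parameters no packing has maximum PPC size ρ.
Isβ : (ρ v k b : ℕ) → Set
Isβ ρ v k b =
  (∃[ P ] MaximumPPCSize {v} {k} P ρ × length (blocks P) ≡ b) ×
  (∀ (P : Packing v k) → MaximumPPCSize P ρ → length (blocks P) ≤ b)

{-# OPTIONS --safe #-}

-- Upper bound, for block size k.  Call a point heavy if it lies on more than k·ρ
-- blocks.  A heavy point outside a set of at most k·ρ points has a block missing
-- that set, because the blocks through it meet the set in distinct points.
-- Hence a PPC M missing a set H of heavy points extends greedily, and |H| + |M| ≤ ρ.
-- Taking for H all heavy points and for M a maximal PPC of blocks missing H, every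
-- block either meets H, and a star count over H bounds those, or passes through a
-- light point of M, so that the number of the latter is bounded independently of v.
--
-- β exists because being the size of such a packing is a decidable property of
-- numbers, bounded above.
--
-- Lower bound.  Five edge-disjoint parallel classes of a transversal design on 3n
-- points, the i-th one extended by a new point ∞ᵢ, together with one block on
-- ∞₀, …, ∞₃.  Every block contains some ∞ᵢ, so no PPC has six blocks.

module Submission where

open import Data.Nat using (ℕ; zero; suc; _+_; _*_; _∸_; _≤_; _<_; _≥_; _/_; _%_; z≤n; s≤s; s≤s⁻¹; _<?_; NonZero; >-nonZero; ⌊_/2⌋)
open import Data.Nat.Properties
open import Data.Nat.DivMod
open import Data.Nat.Tactic.RingSolver using (solve-∀)
open import Algebra.Properties.CommutativeSemigroup +-commutativeSemigroup using (interchange)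
open import Data.Bool.Properties using () renaming (_≟_ to _≟ᵇ_)
open import Data.Fin using (Fin; zero; suc; toℕ; join; splitAt; combine; inject≤; inject₁) renaming (_<_ to _<ᶠ_)
open import Data.Fin.Patterns using (0F; 1F; 2F; 3F)
import Data.Fin.Properties as Fin
open import Data.Fin.Subset using (Subset; inside; outside; ∣_∣; Nonempty; _∩_; _∪_; ∁; ⁅_⁆; ⊥; ⋃; _⊆_) renaming (_∈_ to _∈ₛ_; _∉_ to _∉ₛ_)
open import Data.Fin.Subset.Properties
open import Data.List using (List; []; _∷_; _++_; length; map; filter; allFin; tabulate; cartesianProduct)
open import Data.List.Properties using (length-map; length-++; length-tabulate)
open import Data.List.Membership.Propositional using (_∈_; find)
open import Data.List.Membership.Propositional.Properties
import Data.List.Membership.DecPropositional as DecMembership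
open import Data.List.Relation.Binary.Subset.Propositional using () renaming (_⊆_ to _⊆ₗ_)
open import Data.List.Relation.Unary.All as All using (All; []; _∷_)
import Data.List.Relation.Unary.All.Properties as All
open import Data.List.Relation.Unary.Any as Any using (Any; here; there)
open import Data.List.Relation.Unary.AllPairs as AllPairs using (AllPairs; []; _∷_; allPairs?)
import Data.List.Relation.Unary.AllPairs.Properties as AllPairs
open import Data.List.Relation.Unary.Unique.Propositional using (Unique)
import Data.List.Relation.Unary.Unique.Propositional.Properties as Unique
import Data.List.Relation.Unary.Unique.DecPropositional as DecUnique
open import Data.Product using (_×_; _,_; proj₁; proj₂; ∃-syntax; uncurry)
open import Data.Sum using (_⊎_; inj₁; inj₂; [_,_]′; map₂)
open import Data.Sum.Properties using (inj₁-injective; inj₂-injective)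
open import Data.Vec using ([]; _∷_)
import Data.Vec as Vec
import Data.Vec.Properties as Vec
open import Function using (_∘_; id; _on_)
open import Relation.Nullary using (¬_; Dec; yes; no; ¬?; contradiction; _×-dec_; _→-dec_)
open import Relation.Nullary.Decidable using (map′)
open import Relation.Unary using (Pred; Decidable)
open import Relation.Binary using (Rel; DecidableEquality; tri<; tri≈; tri>)
open import Relation.Binary.PropositionalEquality
open import Defs

-- Counting in filtered lists

module _ {a p} {A : Set a} {P : Pred A p} (P? : Decidable P) where

  length-filter-∁ : ∀ xs → length (filter P? xs) + length (filter (¬? ∘ P?) xs) ≡ length xs
  length-filter-∁ [] = refl
  length-filter-∁ (x ∷ xs) with P? x
  ... | yes _ = cong suc (length-filter-∁ xs)
  ... | no  _ = trans (+-suc _ _) (cong suc (length-filter-∁ xs))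

module _ {a p q} {A : Set a} {P : Pred A p} {Q : Pred A q} (P? : Decidable P) (Q? : Decidable Q) where

  length-filter-filter : ∀ xs → length (filter P? (filter Q? xs)) ≤ length (filter P? xs)
  length-filter-filter [] = z≤n
  length-filter-filter (x ∷ xs) with Q? x
  ... | yes _ with P? x
  ...   | yes _ = s≤s (length-filter-filter xs)
  ...   | no  _ = length-filter-filter xs
  length-filter-filter (x ∷ xs) | no _ with P? x
  ...   | yes _ = m≤n⇒m≤1+n (length-filter-filter xs)
  ...   | no  _ = length-filter-filter xs

unique⇒allPairs : ∀ {a r} {A : Set a} {R : Rel A r} {xs} → Unique xs →
                  (∀ {x y} → x ∈ xs → y ∈ xs → x ≢ y → R x y) → AllPairs R xs
unique⇒allPairs []       f = []
unique⇒allPairs (p ∷ ps) f =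
  All.tabulate (λ y∈ → f (here refl) (there y∈) (All.lookup p y∈)) ∷
  unique⇒allPairs ps (λ x∈ y∈ → f (there x∈) (there y∈))

-- Sizes of finite subsets

∣p∪q∣≤∣p∣+∣q∣ : ∀ {n} (p q : Subset n) → ∣ p ∪ q ∣ ≤ ∣ p ∣ + ∣ q ∣
∣p∪q∣≤∣p∣+∣q∣ []            []            = z≤n
∣p∪q∣≤∣p∣+∣q∣ (inside  ∷ p) (inside  ∷ q) =
  s≤s (≤-trans (∣p∪q∣≤∣p∣+∣q∣ p q) (+-monoʳ-≤ ∣ p ∣ (n≤1+n _)))
∣p∪q∣≤∣p∣+∣q∣ (inside  ∷ p) (outside ∷ q) = s≤s (∣p∪q∣≤∣p∣+∣q∣ p q)
∣p∪q∣≤∣p∣+∣q∣ (outside ∷ p) (inside  ∷ q) =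
  ≤-trans (s≤s (∣p∪q∣≤∣p∣+∣q∣ p q)) (≤-reflexive (sym (+-suc _ _)))
∣p∪q∣≤∣p∣+∣q∣ (outside ∷ p) (outside ∷ q) = ∣p∪q∣≤∣p∣+∣q∣ p q

∣p∪q∣≡∣p∣+∣q∣ : ∀ {n} (p q : Subset n) → Disjoint p q → ∣ p ∪ q ∣ ≡ ∣ p ∣ + ∣ q ∣
∣p∪q∣≡∣p∣+∣q∣ []            []            dis = refl
∣p∪q∣≡∣p∣+∣q∣ (inside  ∷ p) (inside  ∷ q) dis = contradiction (zero , Vec.here) dis
∣p∪q∣≡∣p∣+∣q∣ (inside  ∷ p) (outside ∷ q) dis =
  cong suc (∣p∪q∣≡∣p∣+∣q∣ p q (drop-∷-Empty dis))
∣p∪q∣≡∣p∣+∣q∣ (outside ∷ p) (inside  ∷ q) dis =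
  trans (cong suc (∣p∪q∣≡∣p∣+∣q∣ p q (drop-∷-Empty dis))) (sym (+-suc _ _))
∣p∪q∣≡∣p∣+∣q∣ (outside ∷ p) (outside ∷ q) dis = ∣p∪q∣≡∣p∣+∣q∣ p q (drop-∷-Empty dis)

module _ {n : ℕ} where

  ∣⁅x⁆∪p∣≡1+∣p∣ : ∀ {x} {p : Subset n} → x ∉ₛ p → ∣ ⁅ x ⁆ ∪ p ∣ ≡ suc ∣ p ∣
  ∣⁅x⁆∪p∣≡1+∣p∣ {x} {p} x∉p = trans
    (∣p∪q∣≡∣p∣+∣q∣ ⁅ x ⁆ p λ (y , y∈) → let (y∈x , y∈p) = x∈p∩q⁻ _ _ y∈ in
      x∉p (subst (_∈ₛ p) (x∈⁅y⁆⇒x≡y x y∈x) y∈p))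
    (cong (_+ ∣ p ∣) (∣⁅x⁆∣≡1 x))

  ∣p∣>0⇒Nonempty : (p : Subset n) → 0 < ∣ p ∣ → Nonempty p
  ∣p∣>0⇒Nonempty p 0<p with nonempty? p
  ... | yes ne = ne
  ... | no  em = contradiction 0<p
    (<-irrefl (sym (trans (cong ∣_∣ (Empty-unique em)) (∣⊥∣≡0 n))))

  Nonempty⇒∣p∣>0 : {p : Subset n} → Nonempty p → 0 < ∣ p ∣
  Nonempty⇒∣p∣>0 {p} (x , x∈p) = subst (_≤ ∣ p ∣) (∣⁅x⁆∣≡1 x)
    (p⊆q⇒∣p∣≤∣q∣ λ y∈ → subst (_∈ₛ p) (sym (x∈⁅y⁆⇒x≡y x y∈)) x∈p)

  ∈⋃⁺ : ∀ {x} {ps : List (Subset n)} {p} → p ∈ ps → x ∈ₛ p → x ∈ₛ ⋃ ps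
  ∈⋃⁺ (here refl) x∈p = p⊆p∪q _ x∈p
  ∈⋃⁺ {ps = q ∷ _} (there p∈) x∈p = q⊆p∪q q _ (∈⋃⁺ p∈ x∈p)

  ∈⋃⁻ : ∀ {x} (ps : List (Subset n)) → x ∈ₛ ⋃ ps → ∃[ p ] p ∈ ps × x ∈ₛ p
  ∈⋃⁻ []       x∈ = contradiction x∈ ∉⊥
  ∈⋃⁻ (p ∷ ps) x∈ with x∈p∪q⁻ p (⋃ ps) x∈
  ... | inj₁ x∈p = p , here refl , x∈p
  ... | inj₂ x∈⋃ = let (q , q∈ , x∈q) = ∈⋃⁻ ps x∈⋃ in q , there q∈ , x∈q

  ∣⋃∣≤ : ∀ {c} {ps : List (Subset n)} → All (λ p → ∣ p ∣ ≤ c) ps → ∣ ⋃ ps ∣ ≤ length ps * c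
  ∣⋃∣≤ {ps = []}     []         = ≤-reflexive (∣⊥∣≡0 n)
  ∣⋃∣≤ {ps = p ∷ ps} (p≤ ∷ ps≤) = ≤-trans (∣p∪q∣≤∣p∣+∣q∣ p (⋃ ps)) (+-mono-≤ p≤ (∣⋃∣≤ ps≤))

  ∣⋃∣≥ : ∀ {c} {ps : List (Subset n)} → All (λ p → c ≤ ∣ p ∣) ps → AllPairs Disjoint ps →
         length ps * c ≤ ∣ ⋃ ps ∣
  ∣⋃∣≥ [] [] = z≤n
  ∣⋃∣≥ {ps = p ∷ ps} (≤p ∷ ≤ps) (d ∷ ds) = ≤-trans (+-mono-≤ ≤p (∣⋃∣≥ ≤ps ds))
    (≤-reflexive (sym (∣p∪q∣≡∣p∣+∣q∣ p (⋃ ps) λ (x , x∈) →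
      let (x∈p , x∈⋃) = x∈p∩q⁻ p (⋃ ps) x∈ ; (q , q∈ , x∈q) = ∈⋃⁻ ps x∈⋃ in
      All.lookup d q∈ (x , x∈p∩q⁺ (x∈p , x∈q)))))

  -- The traces on `T` are disjoint subsets of `T`, so their sizes add up to at most `∣ T ∣`. This
  -- serves both for blocks through a common point and for PPCs whose blocks all meet `T`.
  trace-bound : ∀ {c} {L : List (Subset n)} {T : Subset n} → AllPairs (Disjoint on (_∩ T)) L →
                All (λ B → c ≤ ∣ B ∩ T ∣) L → length L * c ≤ ∣ T ∣
  trace-bound {c} {L} {T} ds c≤ = begin
    length L * c               ≡⟨ cong (_* c) (length-map (_∩ T) L) ⟨
    length (map (_∩ T) L) * c  ≤⟨ ∣⋃∣≥ (All.map⁺ c≤) (AllPairs.map⁺ ds) ⟩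
    ∣ ⋃ (map (_∩ T) L) ∣       ≤⟨ p⊆q⇒∣p∣≤∣q∣ ⋃⊆T ⟩
    ∣ T ∣                      ∎
    where
    open ≤-Reasoning
    ⋃⊆T : ⋃ (map (_∩ T) L) ⊆ T
    ⋃⊆T y∈ with ∈⋃⁻ (map (_∩ T) L) y∈
    ... | p , p∈ , y∈p with ∈-map⁻ (_∩ T) p∈
    ... | B , _ , refl = p∩q⊆q B T y∈p

  fromList : List (Fin n) → Subset n
  fromList xs = ⋃ (map ⁅_⁆ xs)

  ∈fromList⁺ : ∀ {x xs} → x ∈ xs → x ∈ₛ fromList xs
  ∈fromList⁺ {x} x∈ = ∈⋃⁺ (∈-map⁺ ⁅_⁆ x∈) (x∈⁅x⁆ x)

  ∈fromList⁻ : ∀ {x} xs → x ∈ₛ fromList xs → x ∈ xs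
  ∈fromList⁻ xs x∈ with ∈⋃⁻ (map ⁅_⁆ xs) x∈
  ... | p , p∈ , x∈p with ∈-map⁻ ⁅_⁆ p∈
  ... | y , y∈ , refl = subst (_∈ xs) (sym (x∈⁅y⁆⇒x≡y y x∈p)) y∈

  ∣fromList∣ : ∀ {xs} → Unique xs → ∣ fromList xs ∣ ≡ length xs
  ∣fromList∣ []            = ∣⊥∣≡0 n
  ∣fromList∣ {x ∷ xs} (x≢ ∷ u) = trans
    (∣⁅x⁆∪p∣≡1+∣p∣ λ x∈ → All.lookup x≢ (∈fromList⁻ xs x∈) refl)
    (cong suc (∣fromList∣ u))

elements : ∀ {n} → Subset n → List (Fin n)
elements []            = []
elements (inside  ∷ p) = zero ∷ map suc (elements p)
elements (outside ∷ p) = map suc (elements p)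

length-elements : ∀ {n} (p : Subset n) → length (elements p) ≡ ∣ p ∣
length-elements []            = refl
length-elements (inside  ∷ p) = cong suc (trans (length-map suc (elements p)) (length-elements p))
length-elements (outside ∷ p) = trans (length-map suc (elements p)) (length-elements p)

∈elements⁺ : ∀ {n x} {p : Subset n} → x ∈ₛ p → x ∈ elements p
∈elements⁺ {x = zero}                      Vec.here       = here refl
∈elements⁺ {x = suc x} {p = inside  ∷ p} (Vec.there x∈) = there (∈-map⁺ suc (∈elements⁺ x∈))
∈elements⁺ {x = suc x} {p = outside ∷ p} (Vec.there x∈) = ∈-map⁺ suc (∈elements⁺ x∈)

∈elements⁻ : ∀ {n x} (p : Subset n) → x ∈ elements p → x ∈ₛ p
∈elements⁻ (inside  ∷ p) (here refl) = Vec.here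
∈elements⁻ (inside  ∷ p) (there x∈) with ∈-map⁻ suc x∈
... | y , y∈ , refl = Vec.there (∈elements⁻ p y∈)
∈elements⁻ (outside ∷ p) x∈ with ∈-map⁻ suc x∈
... | y , y∈ , refl = Vec.there (∈elements⁻ p y∈)

disjoint? : ∀ {n} (p q : Subset n) → Dec (Disjoint p q)
disjoint? p q = ¬? (nonempty? (p ∩ q))

-- Upper bound: counting blocks by the points they pass through

hits : ∀ {n} → List (Fin n) → Subset n → Set
hits xs B = Any (_∈ₛ B) xs

hits? : ∀ {n} (xs : List (Fin n)) → Decidable (hits xs)
hits? xs B = Any.any? (_∈? B) xs

-- The sum (s + 1) + … + (s + h): when blocks are assigned to the first of h points
-- they contain, the j-th point has only v − s − j points left to form blocks with.
tri : ℕ → ℕ → ℕ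
tri zero    s = 0
tri (suc h) s = suc s + tri h (suc s)

-- Blocks have `suc k` points, so that `k` counts the points of a block other than a given one.
module UpperBound {v k ρ : ℕ} (P : Packing v (suc k)) where

  through : Fin v → List (Subset v) → List (Subset v)
  through x = filter (x ∈?_)

  size : ∀ {B} → B ∈ blocks P → ∣ B ∣ ≡ suc k
  size = All.lookup (block-size P)

  nonempty : ∀ {B} → B ∈ blocks P → Nonempty B
  nonempty B∈ = ∣p∣>0⇒Nonempty _ (subst (0 <_) (sym (size B∈)) (s≤s z≤n))

  -- Two distinct blocks through `x` share no second point, and `x` is not in `T`, so their traces
  -- on `T` are disjoint.
  star-bound : ∀ {c x} {L : List (Subset v)} {T : Subset v} → Unique L → L ⊆ₗ blocks P →
               All (x ∈ₛ_) L → x ∉ₛ T → All (λ B → c ≤ ∣ B ∩ T ∣) L → length L * c ≤ ∣ T ∣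
  star-bound {T = T} u L⊆ x∈ x∉T = trace-bound (unique⇒allPairs u λ {B} {C} B∈ C∈ B≢C (y , y∈) →
    let (y∈BT , y∈CT) = x∈p∩q⁻ (B ∩ T) (C ∩ T) y∈
        (y∈B , y∈T) = x∈p∩q⁻ B T y∈BT
        (y∈C , _) = x∈p∩q⁻ C T y∈CT
    in B≢C (at-most-one P (λ { refl → x∉T y∈T }) (L⊆ B∈) (L⊆ C∈)
         (All.lookup x∈ B∈) y∈B (All.lookup x∈ C∈) y∈C))

  -- Remove the at most `d` blocks through the first point; the remaining blocks are hit by the
  -- other points.
  cover-bound : ∀ {d} {L : List (Subset v)} xs → All (λ x → length (through x L) ≤ d) xs →
                All (hits xs) L → length L ≤ length xs * d
  cover-bound {L = []}    []       _        _        = z≤n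
  cover-bound {L = _ ∷ _} []       _        (() ∷ _)
  cover-bound {d} {L}     (x ∷ xs) (≤d ∷ ≤ds) hit = begin
    length L                                ≡⟨ length-filter-∁ (x ∈?_) L ⟨
    length (through x L) + length L′        ≤⟨ +-mono-≤ ≤d (cover-bound xs
                                                 (All.map (λ {y} → ≤-trans (length-filter-filter
                                                   (y ∈?_) (¬? ∘ (x ∈?_)) L)) ≤ds) hit′) ⟩
    d + length xs * d                       ∎
    where
    open ≤-Reasoning
    L′ = filter (¬? ∘ (x ∈?_)) L
    hit′ : All (hits xs) L′
    hit′ = All.tabulate λ B∈ → let (B∈L , x∉B) = ∈-filter⁻ (¬? ∘ (x ∈?_)) {xs = L} B∈ in
      Any.tail x∉B (All.lookup hit B∈L)

  -- `S` collects the points already treated. The blocks through `x` take `k` points each,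
  -- disjointly, from the complement of `S` and `x`, so their number times `k` is at most v - (s +
  -- 1). The other blocks avoid `S′` as well and go into the recursion. Keeping `tri` on the left
  -- avoids truncated subtraction.
  sequential-bound : ∀ {S} {L : List (Subset v)} xs → Unique xs → All (_∉ₛ S) xs →
                     Unique L → L ⊆ₗ blocks P → All (Disjoint S) L → All (hits xs) L →
                     length L * k + tri (length xs) ∣ S ∣ ≤ length xs * v
  sequential-bound {L = []}    [] _ _ _ _ _ _ = z≤n
  sequential-bound {L = _ ∷ _} [] _ _ _ _ _ (() ∷ _)
  sequential-bound {S} {L} (x ∷ xs) (x≢ ∷ uxs) (x∉S ∷ xs∉S) uL L⊆ dis hit = begin
    length L * k + (suc s + tri h (suc s))
      ≡⟨ cong (λ l → l * k + (suc s + tri h (suc s))) (length-filter-∁ (x ∈?_) L) ⟨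
    (length L₁ + length L₂) * k + (suc s + tri h (suc s))
      ≡⟨ cong (_+ (suc s + tri h (suc s))) (*-distribʳ-+ k (length L₁) (length L₂)) ⟩
    (length L₁ * k + length L₂ * k) + (suc s + tri h (suc s))
      ≡⟨ interchange (length L₁ * k) (length L₂ * k) (suc s) (tri h (suc s)) ⟩
    (length L₁ * k + suc s) + (length L₂ * k + tri h (suc s))
      ≤⟨ +-mono-≤ first rest ⟩
    v + h * v ∎
    where
    open ≤-Reasoning
    s = ∣ S ∣
    h = length xs
    L₁ = through x L
    L₂ = filter (¬? ∘ (x ∈?_)) L
    S′ = ⁅ x ⁆ ∪ S
    ∣S′∣ : ∣ S′ ∣ ≡ suc s
    ∣S′∣ = ∣⁅x⁆∪p∣≡1+∣p∣ x∉S

    -- A block of `L₁` misses `S`, so `x` is its only point in `S′`.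
    k≤ : ∀ {B} → B ∈ L₁ → k ≤ ∣ B ∩ ∁ S′ ∣
    k≤ {B} B∈ = let (B∈L , x∈B) = ∈-filter⁻ (x ∈?_) {xs = L} B∈ in s≤s⁻¹ (begin
      suc k                        ≡⟨ size (L⊆ B∈L) ⟨
      ∣ B ∣                        ≤⟨ p⊆q⇒∣p∣≤∣q∣ (B⊆ B∈L) ⟩
      ∣ ⁅ x ⁆ ∪ (B ∩ ∁ S′) ∣       ≤⟨ ∣p∪q∣≤∣p∣+∣q∣ ⁅ x ⁆ (B ∩ ∁ S′) ⟩
      ∣ ⁅ x ⁆ ∣ + ∣ B ∩ ∁ S′ ∣     ≡⟨ cong (_+ ∣ B ∩ ∁ S′ ∣) (∣⁅x⁆∣≡1 x) ⟩
      suc ∣ B ∩ ∁ S′ ∣             ∎)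
      where
      B⊆ : B ∈ L → B ⊆ ⁅ x ⁆ ∪ (B ∩ ∁ S′)
      B⊆ B∈L {y} y∈B with y ∈? ⁅ x ⁆
      ... | yes y∈x = p⊆p∪q _ y∈x
      ... | no  y∉x = q⊆p∪q ⁅ x ⁆ _ (x∈p∩q⁺ (y∈B , x∉p⇒x∈∁p λ y∈S′ →
        [ y∉x , (λ y∈S → All.lookup dis B∈L (y , x∈p∩q⁺ (y∈S , y∈B))) ]′ (x∈p∪q⁻ ⁅ x ⁆ S y∈S′)))

    first : length L₁ * k + suc s ≤ v
    first = subst (λ t → length L₁ * k + t ≤ v) ∣S′∣ (m≤o∸n⇒m+n≤o (length L₁ * k) (∣p∣≤n S′)
      (subst (length L₁ * k ≤_) (∣∁p∣≡n∸∣p∣ S′)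
        (star-bound (Unique.filter⁺ (x ∈?_) uL)
          (L⊆ ∘ proj₁ ∘ ∈-filter⁻ (x ∈?_) {xs = L})
          (All.all-filter (x ∈?_) L)
          (λ x∈∁ → x∈∁p⇒x∉p x∈∁ (p⊆p∪q S (x∈⁅x⁆ x)))
          (All.tabulate k≤))))

    rest : length L₂ * k + tri h (suc s) ≤ h * v
    rest = subst (λ t → length L₂ * k + tri h t ≤ h * v) ∣S′∣
      (sequential-bound {S′} {L₂} xs uxs
        (All.zipWith (λ { (x≢y , y∉S) y∈ →
            [ (λ y∈x → x≢y (sym (x∈⁅y⁆⇒x≡y x y∈x))) , y∉S ]′ (x∈p∪q⁻ ⁅ x ⁆ S y∈) }) (x≢ , xs∉S))
        (Unique.filter⁺ (¬? ∘ (x ∈?_)) uL)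
        (L⊆ ∘ proj₁ ∘ L₂⁻)
        (All.tabulate λ B∈ (y , y∈) → let (y∈S′ , y∈B) = x∈p∩q⁻ S′ _ y∈ in
          [ (λ y∈x → proj₂ (L₂⁻ B∈) (subst (_∈ₛ _) (x∈⁅y⁆⇒x≡y x y∈x) y∈B))
          , (λ y∈S → All.lookup dis (proj₁ (L₂⁻ B∈)) (y , x∈p∩q⁺ (y∈S , y∈B))) ]′
          (x∈p∪q⁻ ⁅ x ⁆ S y∈S′))
        (All.tabulate λ B∈ → Any.tail (proj₂ (L₂⁻ B∈)) (All.lookup hit (proj₁ (L₂⁻ B∈)))))
      where
      L₂⁻ : ∀ {B} → B ∈ L₂ → B ∈ L × x ∉ₛ B
      L₂⁻ = ∈-filter⁻ (¬? ∘ (x ∈?_)) {xs = L}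

  -- Heavy points and greedy extension of PPCs

  Heavy : Fin v → Set
  Heavy x = suc k * ρ < length (through x (blocks P))

  heavy? : Decidable Heavy
  heavy? x = _ <? _

  avoiding-block : ∀ {x T} → Heavy x → x ∉ₛ T → ∣ T ∣ ≤ suc k * ρ →
                   ∃[ B ] B ∈ blocks P × x ∈ₛ B × Disjoint B T
  avoiding-block {x} {T} heavy x∉T T≤ with Any.any? (λ B → disjoint? B T) (through x (blocks P))
  ... | yes any with find any
  ...   | _ , B∈ , dis = let (B∈P , x∈B) = ∈-filter⁻ (x ∈?_) {xs = blocks P} B∈ in _ , B∈P , x∈B , dis
  -- If every block through `x` met `T`, `star-bound` with `c = 1` would give at most `∣ T ∣` of
  -- them, against heaviness.
  avoiding-block {x} {T} heavy x∉T T≤ | no none = contradiction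
    (≤-trans (star-bound {c = 1} (Unique.filter⁺ (x ∈?_) (distinct P))
        (proj₁ ∘ ∈-filter⁻ (x ∈?_) {xs = blocks P})
        (All.all-filter (x ∈?_) (blocks P)) x∉T
        (All.map (λ {B} ¬dis → Nonempty⇒∣p∣>0 (meets B ¬dis)) (All.¬Any⇒All¬ _ none)))
      T≤)
    (<⇒≱ (subst (suc k * ρ <_) (sym (*-identityʳ _)) heavy))
    where
    meets : ∀ B → ¬ Disjoint B T → Nonempty (B ∩ T)
    meets B ¬dis with nonempty? (B ∩ T)
    ... | yes ne = ne
    ... | no  em = contradiction em ¬dis

  disjoint⇒unique : ∀ {M} → M ⊆ₗ blocks P → AllPairs Disjoint M → Unique M
  disjoint⇒unique M⊆ []       = []
  disjoint⇒unique M⊆ (d ∷ ds) =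
    All.map (λ { dis refl → let (x , x∈) = nonempty (M⊆ (here refl)) in dis (x , x∈p∩q⁺ (x∈ , x∈)) }) d
    ∷ disjoint⇒unique (M⊆ ∘ there) ds

  Avoids : List (Fin v) → Subset v → Set
  Avoids xs B = All (_∉ₛ B) xs

  -- Each heavy point is traded for a block through it that misses the blocks of `M` and also the
  -- points still to be treated, which keeps the latter usable. The total length stays `suc ρ`;
  -- without `x` there remain `ρ` sets to avoid.
  extend : ∀ xs M → Unique xs → All Heavy xs → M ⊆ₗ blocks P → AllPairs Disjoint M →
           All (Avoids xs) M → length xs + length M ≡ suc ρ → HasPPC P (suc ρ)
  extend [] M _ _ M⊆ ds _ eq = record
    { members = M ; distinct = disjoint⇒unique M⊆ ds ; ⊆-blocks = M⊆ ; disjoint = ds } , eq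
  extend (x ∷ xs) M (x≢ ∷ uxs) (hx ∷ hxs) M⊆ ds av eq =
    extend xs (B ∷ M) uxs hxs
      (λ { (here refl) → B∈ ; (there C∈) → M⊆ C∈ })
      (All.tabulate (λ C∈ (y , y∈) → let (y∈B , y∈C) = x∈p∩q⁻ B _ y∈ in
        dis (y , x∈p∩q⁺ (y∈B , ∈⋃⁺ (∈-++⁺ˡ C∈) y∈C))) ∷ ds)
      (All.tabulate (λ {y} y∈ y∈B →
        dis (y , x∈p∩q⁺ (y∈B , ∈⋃⁺ (∈-++⁺ʳ M (∈-map⁺ ⁅_⁆ y∈)) (x∈⁅x⁆ y)))) ∷ All.map All.tail av)
      (trans (+-suc _ _) eq)
    where
    Ts = M ++ map ⁅_⁆ xs
    T = ⋃ Ts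
    x∉T : x ∉ₛ T
    x∉T x∈ with ∈⋃⁻ Ts x∈
    ... | C , C∈ , x∈C with ∈-++⁻ M C∈
    ...   | inj₁ C∈M = All.head (All.lookup av C∈M) x∈C
    ...   | inj₂ C∈xs with ∈-map⁻ ⁅_⁆ C∈xs
    ...     | y , y∈ , refl = All.lookup x≢ y∈ (x∈⁅y⁆⇒x≡y y x∈C)
    length-Ts : length Ts ≡ ρ
    length-Ts = trans (length-++ M) (trans (cong (length M +_) (length-map ⁅_⁆ xs))
      (trans (+-comm (length M) _) (suc-injective eq)))
    ∣T∣≤ : ∣ T ∣ ≤ suc k * ρ
    -- Each of the `ρ` sets is counted with `suc k` points, even the singletons; this matches the
    -- threshold in `Heavy`.
    ∣T∣≤ = ≤-trans (∣⋃∣≤ (All.++⁺ (All.tabulate (≤-reflexive ∘ size ∘ M⊆))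
             (All.map⁺ (All.tabulate λ {y} _ → ≤-trans (≤-reflexive (∣⁅x⁆∣≡1 y)) (s≤s z≤n)))))
      (≤-reflexive (trans (cong (_* suc k) length-Ts) (*-comm ρ (suc k))))
    avoiding = avoiding-block hx x∉T ∣T∣≤
    B = proj₁ avoiding
    B∈ = proj₁ (proj₂ avoiding)
    dis = proj₂ (proj₂ (proj₂ avoiding))

  -- A surplus is discarded, blocks of `M` first and then points, until the total is exactly
  -- `suc ρ`.
  extend′ : ∀ xs M → Unique xs → All Heavy xs → M ⊆ₗ blocks P → AllPairs Disjoint M →
            All (Avoids xs) M → suc ρ ≤ length xs + length M → HasPPC P (suc ρ)
  extend′ xs M u hs M⊆ ds av ρ≤ with m≤n⇒m<n∨m≡n ρ≤
  ... | inj₂ eq = extend xs M u hs M⊆ ds av (sym eq)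
  extend′ xs (B ∷ M) u hs M⊆ (_ ∷ ds) (_ ∷ av) _ | inj₁ lt =
    extend′ xs M u hs (M⊆ ∘ there) ds av (s≤s⁻¹ (subst (suc ρ <_) (+-suc _ _) lt))
  extend′ (x ∷ xs) [] (_ ∷ u) (_ ∷ hs) M⊆ ds av _ | inj₁ lt = extend′ xs [] u hs M⊆ ds [] (s≤s⁻¹ lt)

  -- A block is added exactly when it misses the union of those chosen from the tail. An added block
  -- meets the new union in itself, as blocks are nonempty.
  maximalPPC : ∀ L → L ⊆ₗ blocks P → ∃[ M ] M ⊆ₗ L × AllPairs Disjoint M ×
               All (λ B → Nonempty (B ∩ ⋃ M)) L
  maximalPPC [] _ = [] , (λ ()) , [] , []
  maximalPPC (B ∷ L) L⊆ with maximalPPC L (L⊆ ∘ there)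
  ... | M , M⊆ , ds , meets with nonempty? (B ∩ ⋃ M)
  ...   | yes ne = M , there ∘ M⊆ , ds , ne ∷ meets
  ...   | no  em = B ∷ M , (λ { (here refl) → here refl ; (there C∈) → there (M⊆ C∈) })
    , All.tabulate (λ C∈ (y , y∈) → let (y∈B , y∈C) = x∈p∩q⁻ B _ y∈ in
        em (y , x∈p∩q⁺ (y∈B , ∈⋃⁺ C∈ y∈C))) ∷ ds
    , (let (x , x∈) = nonempty (L⊆ (here refl)) in x , x∈p∩q⁺ (x∈ , p⊆p∪q _ x∈))
      ∷ All.map (λ {C} (y , y∈) → let (y∈C , y∈M) = x∈p∩q⁻ C _ y∈ in
          y , x∈p∩q⁺ (y∈C , q⊆p∪q B _ y∈M)) meets

  -- Here `h` counts the heavy points and `m` the blocks of a maximal PPC missing them. Both stay in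
  -- the result because the trade-off between them is settled only once `v` is known to be large.
  upper-bound : ¬ HasPPC P (suc ρ) → ∃[ h ] ∃[ m ] h + m ≤ ρ ×
    length (blocks P) * k + tri h 0 ≤ h * v + (m * suc k) * (suc k * ρ) * k
  upper-bound noPPC with maximalPPC (filter (¬? ∘ hits? (filter heavy? (allFin v))) (blocks P))
                           (proj₁ ∘ ∈-filter⁻ (¬? ∘ hits? (filter heavy? (allFin v))))
  ... | M , M⊆ , ds , meets = length H , length M , h+m≤ρ , (begin
      length (blocks P) * k + tri h 0
        ≡⟨ cong (λ l → l * k + tri h 0) (length-filter-∁ (hits? H) (blocks P)) ⟨
      (length L₁ + length L₂) * k + tri h 0
        ≡⟨ cong (_+ tri h 0) (*-distribʳ-+ k (length L₁) (length L₂)) ⟩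
      length L₁ * k + length L₂ * k + tri h 0
        ≡⟨ cong (_+ tri h 0) (+-comm (length L₁ * k) _) ⟩
      length L₂ * k + length L₁ * k + tri h 0
        ≡⟨ +-assoc (length L₂ * k) _ _ ⟩
      length L₂ * k + (length L₁ * k + tri h 0)
        ≤⟨ +-mono-≤ (*-monoˡ-≤ k light-bound) heavy-bound ⟩
      length M * suc k * (suc k * ρ) * k + h * v
        ≡⟨ +-comm _ (h * v) ⟩
      h * v + length M * suc k * (suc k * ρ) * k ∎)
    where
    open ≤-Reasoning
    H = filter heavy? (allFin v)
    h = length H
    L₁ = filter (hits? H) (blocks P)
    L₂ = filter (¬? ∘ hits? H) (blocks P)
    L₂⁻ : ∀ {B} → B ∈ L₂ → B ∈ blocks P × ¬ hits H B
    L₂⁻ = ∈-filter⁻ (¬? ∘ hits? H)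

    uH : Unique H
    uH = Unique.filter⁺ heavy? (Unique.allFin⁺ v)

    h+m≤ρ : h + length M ≤ ρ
    h+m≤ρ = ≮⇒≥ (noPPC ∘ extend′ H M uH (All.all-filter heavy? (allFin v))
      (proj₁ ∘ L₂⁻ ∘ M⊆) ds (All.tabulate (All.¬Any⇒All¬ H ∘ proj₂ ∘ L₂⁻ ∘ M⊆)))

    heavy-bound : length L₁ * k + tri h 0 ≤ h * v
    heavy-bound = subst (λ s → length L₁ * k + tri h s ≤ h * v) (∣⊥∣≡0 v)
      (sequential-bound H uH (All.tabulate λ _ → ∉⊥)
        (Unique.filter⁺ (hits? H) (distinct P)) (proj₁ ∘ ∈-filter⁻ (hits? H))
        (All.tabulate λ _ (y , y∈) → ∉⊥ (proj₁ (x∈p∩q⁻ ⊥ _ y∈)))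
        (All.all-filter (hits? H) (blocks P)))

    -- A heavy point would belong to `H`, but the blocks of `M` miss `H`.
    light : ∀ {x} → x ∈ elements (⋃ M) → length (through x L₂) ≤ suc k * ρ
    light {x} x∈ with ∈⋃⁻ M (∈elements⁻ (⋃ M) x∈)
    ... | B , B∈ , x∈B = ≤-trans (length-filter-filter (x ∈?_) (¬? ∘ hits? H) (blocks P)) (≮⇒≥ λ heavy →
        proj₂ (L₂⁻ (M⊆ B∈)) (Any.map (λ { refl → x∈B }) (∈-filter⁺ heavy? (∈-allFin x) heavy)))

    -- By maximality every block missing `H` meets `⋃ M`, which consists of at most
    -- `length M * suc k` light points.
    light-bound : length L₂ ≤ length M * suc k * (suc k * ρ)
    light-bound = begin
      length L₂ ≤⟨ cover-bound (elements (⋃ M)) (All.tabulate light)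
                    (All.map (λ {B} (y , y∈) → let (y∈B , y∈M) = x∈p∩q⁻ B _ y∈ in
                      Any.map (λ { refl → y∈B }) (∈elements⁺ y∈M)) meets) ⟩
      length (elements (⋃ M)) * (suc k * ρ)
        ≤⟨ *-monoˡ-≤ (suc k * ρ) (≤-trans (≤-reflexive (length-elements (⋃ M)))
             (∣⋃∣≤ (All.tabulate (≤-reflexive ∘ size ∘ proj₁ ∘ L₂⁻ ∘ M⊆)))) ⟩
      length M * suc k * (suc k * ρ) ∎

-- Existence of β

_≟ₛ_ : ∀ {n} → DecidableEquality (Subset n)
_≟ₛ_ = Vec.≡-dec _≟ᵇ_

-- There are finitely many subsets of `Fin n`, so the search runs over the head and recurses on the
-- tail.
anyListOfLength? : ∀ {n p} m {Q : Pred (List (Subset n)) p} → Decidable Q →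
                   Dec (∃[ xs ] length xs ≡ m × Q xs)
anyListOfLength? zero    Q? = map′ (λ q → [] , refl , q) (λ { ([] , _ , q) → q }) (Q? [])
anyListOfLength? (suc m) Q? = map′
  (λ (B , xs , eq , q) → B ∷ xs , cong suc eq , q)
  (λ { (B ∷ xs , eq , q) → B , xs , suc-injective eq , q })
  (anySubset? λ B → anyListOfLength? m (Q? ∘ (B ∷_)))

module _ {v : ℕ} where

  -- The content of the record as a predicate on bare lists, to which exhaustive search applies.
  IsPPC : List (Subset v) → Pred (List (Subset v)) _
  IsPPC Bs M = Unique M × All (_∈ Bs) M × AllPairs Disjoint M

  isPPC? : ∀ Bs → Decidable (IsPPC Bs)
  isPPC? Bs M = DecUnique.unique? _≟ₛ_ M ×-dec All.all? (λ B → DecMembership._∈?_ _≟ₛ_ B Bs) M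
    ×-dec allPairs? disjoint? M

  IsPacking : ℕ → Pred (List (Subset v)) _
  IsPacking k Bs = Unique Bs × All (λ B → ∣ B ∣ ≡ k) Bs ×
    (∀ x y → x ≢ y → All (λ B → All (λ C →
      x ∈ₛ B → y ∈ₛ B → x ∈ₛ C → y ∈ₛ C → B ≡ C) Bs) Bs)

  isPacking? : ∀ k → Decidable (IsPacking k)
  isPacking? k Bs = DecUnique.unique? _≟ₛ_ Bs ×-dec All.all? (λ B → ∣ B ∣ ≟ k) Bs ×-dec
    Fin.all? λ x → Fin.all? λ y → ¬? (x Fin.≟ y) →-dec All.all? (λ B → All.all? (λ C →
      (x ∈? B) →-dec (y ∈? B) →-dec (x ∈? C) →-dec (y ∈? C) →-dec (B ≟ₛ C)) Bs) Bs

  module _ {k : ℕ} where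

    fromIsPacking : ∀ {Bs} → IsPacking k Bs → Packing v k
    fromIsPacking {Bs} (u , s , a) = record
      { blocks = Bs ; distinct = u ; block-size = s
      ; at-most-one = λ x≢y B∈ C∈ → All.lookup (All.lookup (a _ _ x≢y) B∈) C∈ }

    toIsPacking : (P : Packing v k) → IsPacking k (blocks P)
    toIsPacking P = distinct P , block-size P , λ x y x≢y →
      All.tabulate λ B∈ → All.tabulate λ C∈ → at-most-one P x≢y B∈ C∈

    hasPPC? : (P : Packing v k) → ∀ ρ → Dec (HasPPC P ρ)
    hasPPC? P ρ = map′
      (λ (M , eq , u , M⊆ , ds) → record
        { members = M ; distinct = u ; ⊆-blocks = All.lookup M⊆ ; disjoint = ds } , eq)
      (λ (Q , eq) → let open PartialParallelClass Q in
        members , eq , PartialParallelClass.distinct Q , All.tabulate ⊆-blocks , disjoint)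
      (anyListOfLength? ρ (isPPC? (blocks P)))

    -- A packing rebuilt from its list of blocks may carry other proofs; PPCs see only the list.
    HasPPC-cong : ∀ {P P′ : Packing v k} {ρ} → blocks P ≡ blocks P′ → HasPPC P ρ → HasPPC P′ ρ
    HasPPC-cong refl (Q , eq) = record
      { members = members ; distinct = PartialParallelClass.distinct Q
      ; ⊆-blocks = ⊆-blocks ; disjoint = disjoint } , eq
      where open PartialParallelClass Q

    Attained : ℕ → Pred ℕ _
    Attained ρ b = ∃[ P ] MaximumPPCSize {v} {k} P ρ × length (blocks P) ≡ b

    attained? : ∀ ρ → Decidable (Attained ρ)
    attained? ρ b = map′
      (λ (Bs , eq , p , max) → fromIsPacking p , max , eq)
      (λ (P , (has , hasnot) , eq) → blocks P , eq , toIsPacking P ,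
        HasPPC-cong refl has , hasnot ∘ HasPPC-cong refl)
      (anyListOfLength? b maximal?)
      where
      maximal? : Decidable (λ Bs → ∃[ p ] MaximumPPCSize (fromIsPacking {Bs} p) ρ)
      maximal? Bs with isPacking? k Bs
      ... | no ¬p = no (¬p ∘ proj₁)
      ... | yes p = map′ (p ,_)
        (λ (p′ , has , hasnot) → HasPPC-cong refl has , hasnot ∘ HasPPC-cong refl)
        (hasPPC? (fromIsPacking p) ρ ×-dec ¬? (hasPPC? (fromIsPacking p) (suc ρ)))

-- Descend from the bound `u` to the first value satisfying `Q`; the given `m` guarantees a stop.
maximum : ∀ {p} {Q : Pred ℕ p} → Decidable Q → ∀ {m} → Q m → ∀ u → (∀ b → Q b → b ≤ u) →
          ∃[ b ] Q b × (∀ c → Q c → c ≤ b)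
maximum Q? q u bound with Q? u
... | yes qu = u , qu , bound
maximum {Q = Q} Q? q zero    bound | no ¬qu = contradiction (subst Q (n≤0⇒n≡0 (bound _ q)) q) ¬qu
maximum         Q? q (suc u) bound | no ¬qu = maximum Q? q u λ b qb →
  s≤s⁻¹ (≤∧≢⇒< (bound b qb) λ { refl → ¬qu qb })

β-exists : ∀ {ρ v k m} → Attained {v} {k} ρ m → ∀ u → (∀ b → Attained {v} {k} ρ b → b ≤ u) →
           ∃[ b ] Isβ ρ v k b
β-exists {ρ} att u bound = let (b , qb , max) = maximum (attained? ρ) att u bound in
  b , qb , λ P mP → max _ (P , mP , refl)

-- The transversal construction

length-cartesianProduct : ∀ {a b} {A : Set a} {B : Set b} (xs : List A) (ys : List B) →
                          length (cartesianProduct xs ys) ≡ length xs * length ys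
length-cartesianProduct []       ys = refl
length-cartesianProduct (x ∷ xs) ys = trans (length-++ (map (x ,_) ys))
  (cong₂ _+_ (length-map (x ,_) ys) (length-cartesianProduct xs ys))

-- Arithmetic of residues mod `n`

module _ (n : ℕ) .{{_ : NonZero n}} where

  %-congˡ-+ : ∀ a b c → a % n ≡ b % n → (a + c) % n ≡ (b + c) % n
  %-congˡ-+ a b c eq = trans (%-distribˡ-+ a c n)
    (trans (cong (λ t → (t + c % n) % n) eq) (sym (%-distribˡ-+ b c n)))

  -- The natural number `c * n ∸ c` acts as the negative of `c` mod `n`.
  %-cancelʳ-+ : ∀ a b c → (a + c) % n ≡ (b + c) % n → a % n ≡ b % n
  %-cancelʳ-+ a b c eq = trans (sym (undo a))
    (trans (%-congˡ-+ (a + c) (b + c) (c * n ∸ c) eq) (undo b))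
    where
    undo : ∀ a → (a + c + (c * n ∸ c)) % n ≡ a % n
    undo a = trans (cong (_% n) (trans (+-assoc a c _) (cong (a +_) (m+[n∸m]≡n (m≤m*n c n)))))
      ([m+kn]%n≡m%n a c n)

  %-cancelˡ-+ : ∀ c a b → (c + a) % n ≡ (c + b) % n → a % n ≡ b % n
  %-cancelˡ-+ c a b eq = %-cancelʳ-+ a b c
    (trans (cong (_% n) (+-comm a c)) (trans eq (cong (_% n) (+-comm c b))))

  %-injective : ∀ {a b} → a < n → b < n → a % n ≡ b % n → a ≡ b
  %-injective a< b< eq = trans (sym (m<n⇒m%n≡m a<)) (trans eq (m<n⇒m%n≡m b<))

  mod-injective : ∀ a b → a mod n ≡ b mod n → a % n ≡ b % n
  mod-injective a b eq = trans (sym (Fin.toℕ-fromℕ< _)) (trans (cong toℕ eq) (Fin.toℕ-fromℕ< _))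

double-injective : ∀ a b → a + a ≡ b + b → a ≡ b
double-injective a b eq = trans (n≡⌊n+n/2⌋ a) (trans (cong ⌊_/2⌋ eq) (sym (n≡⌊n+n/2⌋ b)))

triple-injective : ∀ a b → a + a + a ≡ b + b + b → a ≡ b
triple-injective a b eq = *-cancelˡ-≡ a b 3 (trans (lem a) (trans eq (sym (lem b))))
  where
  lem : ∀ a → 3 * a ≡ a + a + a
  lem = solve-∀

-- With 13 ≤ n the numbers i + i and i + i + i, for i < 5, are distinct residues mod n.
module Transversal {n v : ℕ} (13≤n : 13 ≤ n) (5+3n≤v : 5 + 3 * n ≤ v) where

  instance
    n-nonZero : NonZero n
    n-nonZero = >-nonZero (≤-trans (s≤s z≤n) 13≤n)

  Point : Set
  Point = Fin 5 ⊎ Fin 3 × Fin n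

  Index : Set
  Index = Fin 5 × Fin n

  -- The five points ∞ᵢ come first, then three columns of `n` points; the points of `Fin v` beyond
  -- these lie on no block.
  ι : Point → Fin v
  ι p = inject≤ (join 5 (3 * n) (map₂ (uncurry combine) p)) 5+3n≤v

  ι-injective : ∀ p q → ι p ≡ ι q → p ≡ q
  ι-injective p q eq = combine-injective p q (trans (sym (Fin.splitAt-join 5 (3 * n) _))
    (trans (cong (splitAt 5) (Fin.inject≤-injective _ _ _ _ eq)) (Fin.splitAt-join 5 (3 * n) _)))
    where
    combine-injective : ∀ p q → map₂ (uncurry combine) p ≡ map₂ (uncurry combine) q → p ≡ q
    combine-injective (inj₁ _)       (inj₁ _)       refl = refl
    combine-injective (inj₂ (c , x)) (inj₂ (d , y)) eq   =
      cong inj₂ (uncurry (cong₂ _,_) (Fin.combine-injective c x d y (inj₂-injective eq)))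
    combine-injective (inj₁ _)       (inj₂ _)       ()
    combine-injective (inj₂ _)       (inj₁ _)       ()

  column : Point → Fin 4
  column (inj₁ _)       = zero
  column (inj₂ (c , _)) = suc c

  -- Lines of slope `i`: for fixed `i` the triples (x, x + i, x + 2i) partition the three columns,
  -- giving one parallel class, extended by ∞ᵢ.
  entry : Index → Fin 4 → Point
  entry (i , x) 0F = inj₁ i
  entry (i , x) 1F = inj₂ (zero , x)
  entry (i , x) 2F = inj₂ (1F , (toℕ x + toℕ i) mod n)
  entry (i , x) 3F = inj₂ (2F , (toℕ x + toℕ i + toℕ i) mod n)

  column-entry : ∀ b c → column (entry b c) ≡ c
  column-entry b 0F = refl
  column-entry b 1F = refl
  column-entry b 2F = refl
  column-entry b 3F = refl

  column≡ : ∀ {p q} → ι p ≡ ι q → column p ≡ column q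
  column≡ {p} {q} eq = cong column (ι-injective p q eq)

  ι-entry-injective : ∀ {b b′ c d} → ι (entry b c) ≡ ι (entry b′ d) → c ≡ d
  ι-entry-injective {b} {b′} {c} {d} eq =
    trans (sym (column-entry b c)) (trans (column≡ {entry b c} {entry b′ d} eq) (column-entry b′ d))

  value : ∀ {c} {x y : Fin n} → _≡_ {A = Point} (inj₂ (c , x)) (inj₂ (c , y)) → x ≡ y
  value refl = refl

  small : ∀ {a} → a ≤ 12 → a < n
  small a≤ = ≤-trans (s≤s a≤) 13≤n

  2*≤ : (i : Fin 5) → toℕ i + toℕ i ≤ 8
  2*≤ i = +-mono-≤ (Fin.toℕ≤pred[n] i) (Fin.toℕ≤pred[n] i)

  2*< : (i : Fin 5) → toℕ i + toℕ i < n
  2*< i = small (≤-trans (2*≤ i) (m≤m+n 8 4))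

  3*< : (i : Fin 5) → toℕ i + toℕ i + toℕ i < n
  3*< i = small (+-mono-≤ (2*≤ i) (Fin.toℕ≤pred[n] i))

  index≡ : ∀ {i j : Fin 5} {x y : Fin n} → toℕ i % n ≡ toℕ j % n → toℕ x % n ≡ toℕ y % n →
           _≡_ {A = Index} (i , x) (j , y)
  index≡ {i} {j} {x} {y} eqᵢ eqₓ = cong₂ _,_
    (Fin.toℕ-injective (%-injective n (small (bound i)) (small (bound j)) eqᵢ))
    (Fin.toℕ-injective (%-injective n (Fin.toℕ<n x) (Fin.toℕ<n y) eqₓ))
    where
    bound : (i : Fin 5) → toℕ i ≤ 12
    bound i = ≤-trans (Fin.toℕ≤pred[n] i) (m≤m+n 4 8)

  -- Entry 0 gives `i`, entry 1 gives `x`, and any other entry then yields the missing one by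
  -- cancellation. Entries 1 and 3 give 2i, which is below `n` and can be halved; entries 2 and 3
  -- differ by `i`.
  two-entries-< : ∀ b b′ {c d} → c <ᶠ d → entry b c ≡ entry b′ c → entry b d ≡ entry b′ d → b ≡ b′
  two-entries-< b b′ {0F} {1F} _ refl refl = refl
  two-entries-< (i , x) (.i , y) {0F} {2F} _ refl eq =
    index≡ refl (%-cancelʳ-+ n (toℕ x) (toℕ y) (toℕ i) (mod-injective n _ _ (value eq)))
  two-entries-< (i , x) (.i , y) {0F} {3F} _ refl eq =
    index≡ refl (%-cancelʳ-+ n (toℕ x) (toℕ y) (toℕ i)
      (%-cancelʳ-+ n (toℕ x + toℕ i) (toℕ y + toℕ i) (toℕ i) (mod-injective n _ _ (value eq))))
  two-entries-< (i , x) (j , .x) {1F} {2F} _ refl eq =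
    index≡ (%-cancelˡ-+ n (toℕ x) (toℕ i) (toℕ j) (mod-injective n _ _ (value eq))) refl
  two-entries-< (i , x) (j , .x) {1F} {3F} _ refl eq =
    index≡ (cong (_% n) (double-injective (toℕ i) (toℕ j) (%-injective n (2*< i) (2*< j)
      (%-cancelˡ-+ n (toℕ x) (toℕ i + toℕ i) (toℕ j + toℕ j)
        (trans (cong (_% n) (sym (+-assoc (toℕ x) (toℕ i) (toℕ i))))
          (trans (mod-injective n _ _ (value eq)) (cong (_% n) (+-assoc (toℕ x) (toℕ j) (toℕ j))))))))) refl
  two-entries-< (i , x) (j , y) {2F} {3F} _ eq₁ eq₂ with
    %-cancelˡ-+ n (toℕ y + toℕ j) (toℕ i) (toℕ j)
      (trans (sym (%-congˡ-+ n (toℕ x + toℕ i) (toℕ y + toℕ j) (toℕ i) (mod-injective n _ _ (value eq₁))))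
        (mod-injective n _ _ (value eq₂)))
  ... | i≡j with index≡ {i} {j} {x} {x} i≡j refl
  ... | refl = index≡ refl
    (%-cancelʳ-+ n (toℕ x) (toℕ y) (toℕ i) (mod-injective n _ _ (value eq₁)))
  two-entries-< b b′ {1F} {1F} (s≤s ())
  two-entries-< b b′ {suc (suc _)} {1F} (s≤s ())
  two-entries-< b b′ {2F} {2F} (s≤s (s≤s ()))
  two-entries-< b b′ {3F} {2F} (s≤s (s≤s ()))
  two-entries-< b b′ {3F} {3F} (s≤s (s≤s (s≤s ())))

  two-entries : ∀ b b′ c d → c ≢ d → entry b c ≡ entry b′ c → entry b d ≡ entry b′ d → b ≡ b′
  two-entries b b′ c d c≢d eq₁ eq₂ with Fin.<-cmp c d
  ... | tri< c<d _   _   = two-entries-< b b′ c<d eq₁ eq₂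
  ... | tri≈ _   c≡d _   = contradiction c≡d c≢d
  ... | tri> _   _   d<c = two-entries-< b b′ d<c eq₂ eq₁

  block : Index → Subset v
  block b = fromList (tabulate (ι ∘ entry b))

  heavyBlock : Subset v
  heavyBlock = fromList (tabulate {n = 4} (ι ∘ inj₁ ∘ inject₁))

  ∈block⁻ : ∀ {x} b → x ∈ₛ block b → ∃[ c ] x ≡ ι (entry b c)
  ∈block⁻ b x∈ = ∈-tabulate⁻ (∈fromList⁻ (tabulate (ι ∘ entry b)) x∈)

  ∈heavyBlock⁻ : ∀ {x} → x ∈ₛ heavyBlock → ∃[ i ] x ≡ ι (inj₁ i)
  ∈heavyBlock⁻ x∈ with ∈-tabulate⁻ (∈fromList⁻ (tabulate {n = 4} (ι ∘ inj₁ ∘ inject₁)) x∈)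
  ... | c , eq = inject₁ c , eq

  entry∈block : ∀ b c → ι (entry b c) ∈ₛ block b
  entry∈block b c = ∈fromList⁺ (∈-tabulate⁺ {f = ι ∘ entry b} c)

  -- The column of a point fixes its position in every transversal block containing it.
  same-entry : ∀ {b b′ c} → ι (entry b c) ∈ₛ block b′ → entry b c ≡ entry b′ c
  same-entry {b} {b′} {c} x∈ with ∈block⁻ b′ x∈
  ... | d , eq with ι-entry-injective {b} {b′} {c} {d} eq
  ... | refl = ι-injective (entry b c) (entry b′ c) eq

  block-meet : ∀ {b b′ x y} → x ≢ y → x ∈ₛ block b → y ∈ₛ block b → x ∈ₛ block b′ → y ∈ₛ block b′ →
               b ≡ b′
  block-meet {b} {b′} x≢y x∈ y∈ x∈′ y∈′ with ∈block⁻ b x∈ | ∈block⁻ b y∈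
  ... | c , refl | d , refl =
    two-entries b b′ c d (λ { refl → x≢y refl }) (same-entry {b} {b′} {c} x∈′) (same-entry {b} {b′} {d} y∈′)

  -- A transversal block has only its entry 0 among the points ∞ᵢ.
  block-heavyBlock-meet : ∀ {b x y} → x ≢ y → x ∈ₛ block b → y ∈ₛ block b →
                          x ∈ₛ heavyBlock → ¬ y ∈ₛ heavyBlock
  block-heavyBlock-meet {b} x≢y x∈ y∈ x∈′ y∈′
    with ∈block⁻ b x∈ | ∈block⁻ b y∈ | ∈heavyBlock⁻ x∈′ | ∈heavyBlock⁻ y∈′
  ... | c , refl | d , refl | i , eqᵢ | j , eqⱼ =
    x≢y (cong (ι ∘ entry b) (trans (first c eqᵢ) (sym (first d eqⱼ))))
    where
    first : ∀ c {i} → ι (entry b c) ≡ ι (inj₁ i) → c ≡ 0F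
    first c {i} eq = trans (sym (column-entry b c)) (column≡ {entry b c} {inj₁ i} eq)

  block-injective : ∀ {b b′} → block b ≡ block b′ → b ≡ b′
  block-injective {b} {b′} eq = two-entries b b′ zero 1F (λ ())
    (same-entry {b} {b′} {0F} (subst (ι (entry b 0F) ∈ₛ_) eq (entry∈block b 0F)))
    (same-entry {b} {b′} {1F} (subst (ι (entry b 1F) ∈ₛ_) eq (entry∈block b 1F)))

  indices : List Index
  indices = cartesianProduct (allFin 5) (allFin n)

  transversal : Packing v 4
  transversal = record
    { blocks = heavyBlock ∷ map block indices
    ; distinct = All.map⁺ (All.tabulate λ {b} _ eq → block-heavyBlock-meet {b}
          (λ e → contradiction (ι-entry-injective {b} {b} {zero} {1F} e) λ ())
          (entry∈block b 0F) (entry∈block b 1F)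
          (subst (ι (entry b 0F) ∈ₛ_) (sym eq) (entry∈block b 0F))
          (subst (ι (entry b 1F) ∈ₛ_) (sym eq) (entry∈block b 1F)))
        ∷ Unique.map⁺ block-injective (Unique.cartesianProduct⁺ (Unique.allFin⁺ 5) (Unique.allFin⁺ n))
    ; block-size =
        ∣fromList∣ (Unique.tabulate⁺ (Fin.inject₁-injective ∘ inj₁-injective ∘ ι-injective _ _))
        ∷ All.map⁺ (All.tabulate λ {b} _ → ∣fromList∣ (Unique.tabulate⁺ (ι-entry-injective {b} {b})))
    ; at-most-one = meet }
    where
    meet : ∀ {x y} → x ≢ y → ∀ {B C} → B ∈ heavyBlock ∷ map block indices →
           C ∈ heavyBlock ∷ map block indices →
           x ∈ₛ B → y ∈ₛ B → x ∈ₛ C → y ∈ₛ C → B ≡ C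
    meet x≢y (here refl) (here refl) _ _ _ _ = refl
    meet x≢y (here refl) (there C∈) x∈ y∈ x∈′ y∈′ with ∈-map⁻ block C∈
    ... | b , _ , refl = contradiction y∈ (block-heavyBlock-meet {b} x≢y x∈′ y∈′ x∈)
    meet x≢y (there B∈) (here refl) x∈ y∈ x∈′ y∈′ with ∈-map⁻ block B∈
    ... | b , _ , refl = contradiction y∈′ (block-heavyBlock-meet {b} x≢y x∈ y∈ x∈′)
    meet x≢y (there B∈) (there C∈) x∈ y∈ x∈′ y∈′ with ∈-map⁻ block B∈ | ∈-map⁻ block C∈
    ... | b , _ , refl | b′ , _ , refl = cong block (block-meet x≢y x∈ y∈ x∈′ y∈′)

  length-transversal : length (blocks transversal) ≡ suc (5 * n)
  length-transversal = cong suc (trans (length-map block indices)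
    (trans (length-cartesianProduct (allFin 5) (allFin n))
      (cong (5 *_) (length-tabulate {n = n} id))))

  -- The maximum PPC size of the transversal packing

  heavyPoints : Subset v
  heavyPoints = fromList (tabulate (ι ∘ inj₁))

  ∣heavyPoints∣ : ∣ heavyPoints ∣ ≡ 5
  ∣heavyPoints∣ = ∣fromList∣ (Unique.tabulate⁺ (inj₁-injective ∘ ι-injective _ _))

  heavy∈ : ∀ {B i} → ι (inj₁ i) ∈ₛ B → 1 ≤ ∣ B ∩ heavyPoints ∣
  heavy∈ {i = i} x∈ = Nonempty⇒∣p∣>0 (_ , x∈p∩q⁺ (x∈ , ∈fromList⁺ (∈-tabulate⁺ {f = ι ∘ inj₁} i)))

  meets-heavyPoints : ∀ {B} → B ∈ blocks transversal → 1 ≤ ∣ B ∩ heavyPoints ∣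
  meets-heavyPoints (here refl) = heavy∈ {i = zero}
    (∈fromList⁺ (∈-tabulate⁺ {n = 4} {f = ι ∘ inj₁ ∘ inject₁} zero))
  meets-heavyPoints (there B∈) with ∈-map⁻ block B∈
  ... | b , _ , refl = heavy∈ {i = proj₁ b} (entry∈block b 0F)

  no-PPC-6 : ¬ HasPPC transversal 6
  -- The disjoint nonempty traces on the five points ∞ᵢ would give 6 ≤ 5, which unfolds to 5 < 5.
  no-PPC-6 (Q , eq) = contradiction (subst₂ _≤_ (trans (*-identityʳ _) eq) ∣heavyPoints∣
    (trace-bound {c = 1} (AllPairs.map shrink disjoint)
      (All.tabulate (meets-heavyPoints ∘ ⊆-blocks)))) (<-irrefl refl)
    where
    open PartialParallelClass Q
    shrink : ∀ {B C} → Disjoint B C → Disjoint (B ∩ heavyPoints) (C ∩ heavyPoints)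
    shrink {B} {C} dis (x , x∈) = let (x∈B , x∈C) = x∈p∩q⁻ (B ∩ heavyPoints) _ x∈ in
      dis (x , x∈p∩q⁺ (p∩q⊆p B _ x∈B , p∩q⊆p C _ x∈C))

  5≤n : 5 ≤ n
  5≤n = ≤-trans (m≤m+n 5 8) 13≤n

  -- With x = i the entries are ∞ᵢ, i, 2i and 3i. Since 3i ≤ 12 < n nothing wraps around, so
  -- different `i` differ in every column.
  diagonal : Fin 5 → Index
  diagonal i = i , inject≤ i 5≤n

  diagonal-disjoint : ∀ {i j} → i ≢ j → Disjoint (block (diagonal i)) (block (diagonal j))
  diagonal-disjoint {i} {j} i≢j (x , x∈) with x∈p∩q⁻ (block (diagonal i)) (block (diagonal j)) x∈
  ... | x∈i , x∈j with ∈block⁻ (diagonal i) x∈i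
  ... | c , refl = i≢j (same c (same-entry {diagonal i} {diagonal j} {c} x∈j))
    where
    same : ∀ c → entry (diagonal i) c ≡ entry (diagonal j) c → i ≡ j
    same zero eq = inj₁-injective eq
    same 1F eq = Fin.inject≤-injective _ _ i j (value eq)
    same 2F eq
      with e ← mod-injective n _ _ (value eq)
      rewrite Fin.toℕ-inject≤ i 5≤n | Fin.toℕ-inject≤ j 5≤n
      = Fin.toℕ-injective (double-injective (toℕ i) (toℕ j) (%-injective n (2*< i) (2*< j) e))
    same 3F eq
      with e ← mod-injective n _ _ (value eq)
      rewrite Fin.toℕ-inject≤ i 5≤n | Fin.toℕ-inject≤ j 5≤n
      = Fin.toℕ-injective (triple-injective (toℕ i) (toℕ j) (%-injective n (3*< i) (3*< j) e))

  PPC-5 : HasPPC transversal 5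
  PPC-5 = record
    { members = map (block ∘ diagonal) (allFin 5)
    ; distinct = Unique.map⁺ (λ {i} {j} eq → cong proj₁ (block-injective {diagonal i} {diagonal j} eq))
        (Unique.allFin⁺ 5)
    ; ⊆-blocks = λ B∈ → let (i , _ , eq) = ∈-map⁻ (block ∘ diagonal) B∈ in
        there (subst (_∈ map block indices) (sym eq)
          (∈-map⁺ block (∈-cartesianProduct⁺ (∈-allFin i) (∈-allFin _))))
    ; disjoint = AllPairs.map⁺ (unique⇒allPairs (Unique.allFin⁺ 5) λ _ _ → diagonal-disjoint)
    } , refl

  attained : Attained {v} {4} 5 (suc (5 * n))
  attained = transversal , (PPC-5 , no-PPC-6) , length-transversal

-- Numerical bounds for blocks of four points and maximum PPC size 5

theorem4p5 : (v : ℕ) → v ≥ 360 →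
    ∃[ β ] Isβ 5 v 4 β ×
    β ≤ (5 * v ∸ 15) / 3 ×
    (v % 3 ≡ 0 → β ≥ (5 * v ∸ 27) / 3) ×
    (v % 3 ≡ 1 → β ≥ (5 * v ∸ 32) / 3) ×
    (v % 3 ≡ 2 → β ≥ (5 * v ∸ 22) / 3)
theorem4p5 v v≥360 = β , isβ , upper β (proj₁ isβ) , lower₀ , lower₁ , lower₂
  where
  upper : ∀ b → Attained {v} {4} 5 b → b ≤ (5 * v ∸ 15) / 3
  upper b (P , (_ , noPPC) , refl) with UpperBound.upper-bound P noPPC
  ... | h , m , h+m≤5 , bound = subst (_≤ (5 * v ∸ 15) / 3) (m*n/n≡m b 3)
    (/-monoˡ-≤ 3 (m+n≤o⇒m≤o∸n (b * 3) (cases (5 ∸ h) (m+[n∸m]≡n (m+n≤o⇒m≤o h h+m≤5)) bound)))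
    where
    cases : ∀ g → h + g ≡ 5 → b * 3 + tri h 0 ≤ h * v + m * 4 * 20 * 3 → b * 3 + 15 ≤ 5 * v
    -- Five heavy points leave no room for light blocks: m = 0, and `tri 5 0` is the 15 of the
    -- bound.
    cases zero eq le with trans (sym (+-identityʳ h)) eq
    ... | refl with n≤0⇒n≡0 (+-cancelˡ-≤ 5 m 0 h+m≤5)
    ... | refl = subst (b * 3 + 15 ≤_) (+-identityʳ (5 * v)) le
    -- Each of the `g` missing heavy points costs `v`, while m ≤ g blocks of `M` contribute 4 · 20 ·
    -- 3 = 240 each. Adding 15 ≤ 15g, it suffices that 255 ≤ v.
    cases g@(suc g′) eq le = begin
      b * 3 + 15                          ≤⟨ +-monoˡ-≤ 15 (m+n≤o⇒m≤o (b * 3) le) ⟩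
      h * v + m * 4 * 20 * 3 + 15         ≡⟨ regroup (h * v) m ⟩
      h * v + (m * 240 + 15)              ≤⟨ +-monoʳ-≤ (h * v) (+-mono-≤ (*-monoˡ-≤ 240 m≤g) (m≤n*m 15 g)) ⟩
      h * v + (g * 240 + g * 15)          ≡⟨ cong (h * v +_) (*-distribˡ-+ g 240 15) ⟨
      h * v + g * 255                     ≤⟨ +-monoʳ-≤ (h * v) (*-monoʳ-≤ g (≤-trans (m≤m+n 255 105) v≥360)) ⟩
      h * v + g * v                       ≡⟨ *-distribʳ-+ v h g ⟨
      (h + g) * v                         ≡⟨ cong (_* v) eq ⟩
      5 * v                               ∎
      where
      open ≤-Reasoning
      regroup : ∀ a m → a + m * 4 * 20 * 3 + 15 ≡ a + (m * 240 + 15)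
      regroup = solve-∀
      m≤g : m ≤ g
      m≤g = +-cancelˡ-≤ h m g (≤-trans h+m≤5 (≤-reflexive (sym eq)))

  -- Any one attained size suffices here; n = 13 uses 5 + 39 = 44 points.
  existence = β-exists (Transversal.attained {13} {v} ≤-refl (≤-trans (m≤m+n 44 316) v≥360)) _ upper
  β = proj₁ existence
  isβ = proj₂ existence

  -- With `r` points left over, 5v = 15n + 5(5 + r) = 15n + 3 + c, so (5v - c)/3 is exactly the
  -- number 5n + 1 of blocks.
  lower : ∀ n r {c} → v ≡ 5 + 3 * n + r → 5 * (5 + r) ≡ 3 + c → r ≤ 2 → β ≥ (5 * v ∸ c) / 3
  lower n r {c} v≡ c≡ r≤2 = subst (_≤ β) (sym quotient)
    (let (P , max , eq) = Transversal.attained {n} {v} 13≤n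
           (subst (5 + 3 * n ≤_) (sym v≡) (m≤m+n _ r))
     in subst (_≤ β) eq (proj₂ isβ P max))
    where
    13≤n : 13 ≤ n
    -- From 7 + 39 = 46 ≤ v ≤ 7 + 3n.
    13≤n = *-cancelˡ-≤ 3 (+-cancelˡ-≤ 7 39 (3 * n) (begin
      46              ≤⟨ ≤-trans (m≤m+n 46 314) v≥360 ⟩
      v               ≡⟨ v≡ ⟩
      5 + 3 * n + r   ≤⟨ +-monoʳ-≤ (5 + 3 * n) r≤2 ⟩
      5 + 3 * n + 2   ≡⟨ swap n ⟩
      7 + 3 * n       ∎))
      where
      open ≤-Reasoning
      swap : ∀ n → 5 + 3 * n + 2 ≡ 7 + 3 * n
      swap = solve-∀
    expand : ∀ n r → 5 * (5 + 3 * n + r) ≡ 5 * n * 3 + 5 * (5 + r)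
    expand = solve-∀
    quotient : (5 * v ∸ c) / 3 ≡ suc (5 * n)
    quotient = trans (cong (_/ 3) (begin
      5 * v ∸ c                         ≡⟨ cong (λ w → 5 * w ∸ c) v≡ ⟩
      5 * (5 + 3 * n + r) ∸ c           ≡⟨ cong (_∸ c) (expand n r) ⟩
      5 * n * 3 + 5 * (5 + r) ∸ c       ≡⟨ cong (λ t → 5 * n * 3 + t ∸ c) c≡ ⟩
      5 * n * 3 + (3 + c) ∸ c           ≡⟨ cong (_∸ c) (+-assoc (5 * n * 3) 3 c) ⟨
      5 * n * 3 + 3 + c ∸ c             ≡⟨ m+n∸n≡m (5 * n * 3 + 3) c ⟩
      5 * n * 3 + 3                     ≡⟨ +-comm (5 * n * 3) 3 ⟩
      suc (5 * n) * 3                   ∎)) (m*n/n≡m (suc (5 * n)) 3)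
      where open ≡-Reasoning

  split : ∀ {r} → v % 3 ≡ r → v ≡ r + v / 3 * 3
  split refl = m≡m%n+[m/n]*n v 3

  2≤v/3 : 2 ≤ v / 3
  2≤v/3 = /-monoˡ-≤ 3 (≤-trans (m≤m+n 6 354) v≥360)

  v/3≡ : v / 3 ≡ 2 + (v / 3 ∸ 2)
  v/3≡ = sym (m+[n∸m]≡n 2≤v/3)

  -- Modulo 3, v - 5 agrees with v + 1, so the residues 0, 1, 2 of `v` leave r = 1, 2, 0 points
  -- over; `n` is v/3 - 2, except v/3 - 1 in the last case.
  lower₀ : v % 3 ≡ 0 → β ≥ (5 * v ∸ 27) / 3
  lower₀ eq = lower (v / 3 ∸ 2) 1
    (trans (split eq) (trans (cong (_* 3) v/3≡) (lem (v / 3 ∸ 2)))) refl (s≤s z≤n)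
    where
    lem : ∀ q → (2 + q) * 3 ≡ 5 + 3 * q + 1
    lem = solve-∀

  lower₁ : v % 3 ≡ 1 → β ≥ (5 * v ∸ 32) / 3
  lower₁ eq = lower (v / 3 ∸ 2) 2
    (trans (split eq) (trans (cong (λ q → 1 + q * 3) v/3≡) (lem (v / 3 ∸ 2)))) refl ≤-refl
    where
    lem : ∀ q → 1 + (2 + q) * 3 ≡ 5 + 3 * q + 2
    lem = solve-∀

  lower₂ : v % 3 ≡ 2 → β ≥ (5 * v ∸ 22) / 3
  lower₂ eq = lower (suc (v / 3 ∸ 2)) 0
    (trans (split eq) (trans (cong (λ q → 2 + q * 3) v/3≡) (lem (v / 3 ∸ 2)))) refl z≤n
    where
    lem : ∀ q → 2 + (2 + q) * 3 ≡ 5 + 3 * (1 + q) + 0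
    lem = solve-∀
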